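{- Let $\varepsilon>0$ and $r\ge 3$. Every $\varepsilon$-ultra maximal $K_r$-free graph $G$ satisfies $\nu_{\mathrm{bi}}(G)\le (2/\varepsilon)^{2/\varepsilon}$.
   Context: An $n$-vertex graph $G$ is $\varepsilon$-ultra maximal $K_r$-free if it is $K_r$-free and for every pair of non-adjacent vertices $u,v$, the induced subgraph $G[N(u)\cap N(v)]$ contains at least $\varepsilon n^{r-2}$ copies of $K_{r-2}$. A bipartite induced matching of size $t$ in $G$ is a set of $2t$ distinct vertices $u_1,\dots,u_t,v_1,\dots,v_t$ with $u_iv_j\in E(G)$ if and only if $i=j$; $\nu_{\mathrm{bi}}(G)$ is the maximum size of a bipartite induced matching in $G$.
   Formalization: The formal theorem adds the hypothesis ε ≤ 2, since the claim fails for ε > 2: K_2 with r = 3 has no non-adjacent pair and ν_bi = 1, but (2/ε)^(2/ε) < 1. A graph with a pair of distinct non-adjacent vertices can only be ε-ultra maximal when ε ≤ 1. -}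

module Defs where

open import Data.Bool using (Bool; true; false)
open import Data.Fin using (Fin)
import Data.Fin.Properties as Fin
open import Data.Fin.Subset using (Subset; _∈_; _⊆_; _∩_; ∣_∣)
open import Data.Fin.Subset.Properties using (_∈?_; _⊆?_)
open import Data.Integer using (+_)
open import Data.List as List using (List; length; filter)
open import Data.Nat as ℕ using (ℕ; zero; suc; NonZero)
import Data.Nat.Properties as ℕ
open import Data.Product using (∃; ∃-syntax; ∃₂; _×_; _,_)
open import Data.Rational as ℚ using (ℚ; 0ℚ; 1ℚ; Positive; +-*-rawSemiring)
import Data.Rational.Properties as ℚ
open import Algebra.Definitions.RawSemiring +-*-rawSemiring using () renaming (_^_ to _^ℚ_)
open import Data.Rational.Literals using (fromℤ)
open import Data.Sum as Sum using (_⊎_; inj₁; inj₂)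
open import Data.Vec as Vec using (Vec; []; _∷_; _++_; lookup; tabulate)
import Data.Vec.Relation.Unary.AllPairs as AllPairs
open import Data.Vec.Relation.Unary.AllPairs using ([])
open import Data.Vec.Relation.Unary.Unique.Propositional using (Unique)
open import Data.Vec.Relation.Unary.Unique.Propositional.Properties
  using (lookup-injective)
open import Function using (_∘_; _⇔_; mk⇔; Equivalence)
open import Relation.Binary using (Decidable; Symmetric; Irreflexive)
open import Relation.Binary.PropositionalEquality
open import Relation.Nullary
open import Relation.Nullary.Decidable using (map′; ¬?; _×-dec_; _→-dec_; does)
import Relation.Unary as U

------------------------------------------------------------------------
-- Finite simple graphs

record Graph (n : ℕ) : Set₁ where
  field
    Adj    : Fin n → Fin n → Set
    adj?   : Decidable Adj
    symm   : Symmetric Adj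
    irrefl : Irreflexive _≡_ Adj

  N : Fin n → Subset n
  N u = tabulate (does ∘ adj? u)

  IsClique : Subset n → Set
  IsClique S = ∀ x y → x ∈ S → y ∈ S → x ≢ y → Adj x y

  isClique? : U.Decidable IsClique
  isClique? S = Fin.all? λ x → Fin.all? λ y →
    (x ∈? S) →-dec (y ∈? S) →-dec ¬? (x Fin.≟ y) →-dec adj? x y

  -- S is the vertex set of a copy of K_k in the induced subgraph on A.
  IsCopy : ℕ → Subset n → Subset n → Set
  IsCopy k A S = ∣ S ∣ ≡ k × S ⊆ A × IsClique S

  isCopy? : ∀ k A → U.Decidable (IsCopy k A)
  isCopy? k A S = (∣ S ∣ ℕ.≟ k) ×-dec (S ⊆? A) ×-dec isClique? S

open Graph public

-- Every subset of Fin n occurs exactly once.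
subsets : ∀ n → List (Subset n)
subsets zero    = List.[ [] ]
subsets (suc n) = List.map (true ∷_) (subsets n) List.++ List.map (false ∷_) (subsets n)

copies : ∀ {n} → Graph n → ℕ → Subset n → ℕ
copies {n} G k A = length (filter (isCopy? G k A) (subsets n))

KFree : ∀ {n} → ℕ → Graph n → Set
KFree r G = ∀ S → ∣ S ∣ ≡ r → ¬ IsClique G S

------------------------------------------------------------------------
-- Bipartite induced matchings

IsBipartiteInducedMatching : ∀ {n t} → Graph n → Vec (Fin n) t → Vec (Fin n) t → Set
IsBipartiteInducedMatching G u v =
  Unique (u ++ v) × (∀ i j → Adj G (lookup u i) (lookup v j) ⇔ i ≡ j)

HasBipartiteInducedMatching : ∀ {n} → Graph n → ℕ → Set
HasBipartiteInducedMatching {n} G t =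
  ∃₂ λ (u v : Vec (Fin n) t) → IsBipartiteInducedMatching G u v

isBipartiteInducedMatching? : ∀ {n t} (G : Graph n) (u v : Vec (Fin n) t) →
                              Dec (IsBipartiteInducedMatching G u v)
isBipartiteInducedMatching? G u v =
  AllPairs.allPairs? (λ x y → ¬? (x Fin.≟ y)) (u ++ v)
  ×-dec
  Fin.all? λ i → Fin.all? λ j →
    map′ (λ (f , g) → mk⇔ f g) (λ e → Equivalence.to e , Equivalence.from e)
      ((adj? G (lookup u i) (lookup v j) →-dec (i Fin.≟ j))
       ×-dec ((i Fin.≟ j) →-dec adj? G (lookup u i) (lookup v j)))

anyVec? : ∀ {n} t {P : Vec (Fin n) t → Set} → U.Decidable P → Dec (∃ P)
anyVec? zero    P? = map′ (λ p → [] , p) (λ { ([] , p) → p }) (P? [])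
anyVec? (suc t) P? =
  map′ (λ (x , xs , p) → x ∷ xs , p) (λ { (x ∷ xs , p) → x , xs , p })
    (Fin.any? λ x → anyVec? t λ xs → P? (x ∷ xs))

hasBipartiteInducedMatching? : ∀ {n} (G : Graph n) →
                               U.Decidable (HasBipartiteInducedMatching G)
hasBipartiteInducedMatching? G t =
  anyVec? t λ u → anyVec? t λ v → isBipartiteInducedMatching? G u v

-- The greatest k ≤ m satisfying P, or 0 if there is none.
greatest : {P : ℕ → Set} → U.Decidable P → ℕ → ℕ
greatest P? zero    = zero
greatest P? (suc m) with P? (suc m)
... | yes _ = suc m
... | no  _ = greatest P? m

greatest-satisfies : {P : ℕ → Set} (P? : U.Decidable P) → P 0 → ∀ m → P (greatest P? m)
greatest-satisfies P? p₀ zero    = p₀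
greatest-satisfies P? p₀ (suc m) with P? (suc m)
... | yes p = p
... | no  _ = greatest-satisfies P? p₀ m

greatest-upper : {P : ℕ → Set} (P? : U.Decidable P) →
                 ∀ {k} m → k ℕ.≤ m → P k → k ℕ.≤ greatest P? m
greatest-upper P? zero    k≤m p = k≤m
greatest-upper {P} P? {k} (suc m) k≤m p with P? (suc m)
... | yes _ = k≤m
... | no ¬p = greatest-upper P? m (ℕ.≤-pred (ℕ.≤∧≢⇒< k≤m λ k≡ → ¬p (subst P k≡ p))) p

-- A matching of size t uses 2t vertices, so searching sizes up to n suffices.
ν-bi : ∀ {n} → Graph n → ℕ
ν-bi {n} G = greatest (hasBipartiteInducedMatching? G) n

ν-bi-attained : ∀ {n} (G : Graph n) → HasBipartiteInducedMatching G (ν-bi G)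
ν-bi-attained {n} G =
  greatest-satisfies (hasBipartiteInducedMatching? G) ([] , [] , [] , λ ()) n

ν-bi-maximal : ∀ {n} (G : Graph n) t → HasBipartiteInducedMatching G t → t ℕ.≤ ν-bi G
ν-bi-maximal {n} G t h@(u , v , distinct , _) =
  greatest-upper (hasBipartiteInducedMatching? G) n
    (ℕ.≤-trans (ℕ.m≤m+n t t)
      (Fin.injective⇒≤ λ {i} {j} → lookup-injective distinct i j))
    h

------------------------------------------------------------------------
-- Real numbers as two-sided Dedekind cuts

record ℝ : Set₁ where
  field
    below above : ℚ → Set   -- below q means q < x; above q means x < q
    below-inhabited : ∃[ q ] below q
    above-inhabited : ∃[ q ] above q
    below-down      : ∀ {p q} → p ℚ.< q → below q → below p
    above-up        : ∀ {p q} → p ℚ.< q → above p → above q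
    below-rounded   : ∀ {p} → below p → ∃[ q ] p ℚ.< q × below q
    above-rounded   : ∀ {q} → above q → ∃[ p ] p ℚ.< q × above p
    ordered         : ∀ {p q} → below p → above q → p ℚ.< q
    located         : ∀ {p q} → p ℚ.< q → below p ⊎ above q

open ℝ public

fromℕ : ℕ → ℚ
fromℕ m = fromℤ (+ m)

infix 4 _<ʳ_ _≤ʳ_

_<ʳ_ : ℚ → ℝ → Set
q <ʳ x = below x q

_≤ʳ_ : ℝ → ℚ → Set
x ≤ʳ q = ∀ p → below x p → p ℚ.≤ q

-- x · m ≤ c
infix 4 _·_≤_
_·_≤_ : ℝ → ℕ → ℕ → Set
x · m ≤ c = ∀ p → below x p → p ℚ.* fromℕ m ℚ.≤ fromℕ c

private
  module _ {p : ℚ} (0<p : 0ℚ ℚ.< p) where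
    mono : ∀ {x y} → x ℚ.< y → x ℚ.* p ℚ.< y ℚ.* p
    mono = ℚ.*-monoˡ-<-pos p {{ℚ.positive 0<p}}

    cancel : ∀ {x y} → x ℚ.* p ℚ.< y ℚ.* p → x ℚ.< y
    cancel = ℚ.*-cancelʳ-<-nonNeg p {{ℚ.pos⇒nonNeg p {{ℚ.positive 0<p}}}}

    0<cancel : ∀ {y} → 0ℚ ℚ.< y ℚ.* p → 0ℚ ℚ.< y
    0<cancel {y} h = cancel (subst (ℚ._< y ℚ.* p) (sym (ℚ.*-zeroˡ p)) h)

    divide : ∀ b → ∃[ q ] q ℚ.* p ≡ b
    divide b = b ℚ.* 1/p , (begin
      b ℚ.* 1/p ℚ.* p    ≡⟨ ℚ.*-assoc b 1/p p ⟩
      b ℚ.* (1/p ℚ.* p)  ≡⟨ cong (b ℚ.*_) (ℚ.*-inverseˡ p {{nz}}) ⟩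
      b ℚ.* 1ℚ           ≡⟨ ℚ.*-identityʳ b ⟩
      b                  ∎)
      where
      open ≡-Reasoning
      nz : ℚ.NonZero p
      nz = ℚ.pos⇒nonZero p {{ℚ.positive 0<p}}
      1/p : ℚ
      1/p = (ℚ.1/ p) {{nz}}

-- The quotient a / x of positive numbers.
quotient : (a : ℚ) .{{_ : Positive a}} (x : ℝ) → 0ℚ <ʳ x → ℝ
quotient a x 0<x = record
  { below           = B
  ; above           = A
  ; below-inhabited = let u , xu = above-inhabited x in
                      0ℚ , u , xu , subst (ℚ._< a) (sym (ℚ.*-zeroˡ u)) 0<a
  ; above-inhabited = let l , 0<l , xl = below-rounded x 0<x
                          b , a<b = above-a
                          q , ql≡b = divide 0<l b
                      in q , l , 0<l , xl , subst (a ℚ.<_) (sym ql≡b) a<b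
  ; below-down      = λ { p<q (u , xu , qu<a) →
                          u , xu , ℚ.<-trans (mono (0<u xu) p<q) qu<a }
  ; above-up        = λ { p<q (l , 0<l , xl , a<pl) →
                          l , 0<l , xl , ℚ.<-trans a<pl (mono 0<l p<q) }
  ; below-rounded   = λ { (u , xu , qu<a) →
                          let c , qu<c , c<a = ℚ.<-dense qu<a
                              r , ru≡c = divide (0<u xu) c
                          in r , cancel (0<u xu) (subst (_ ℚ.<_) (sym ru≡c) qu<c)
                           , u , xu , subst (ℚ._< a) (sym ru≡c) c<a }
  ; above-rounded   = λ { (l , 0<l , xl , a<ql) →
                          let c , a<c , c<ql = ℚ.<-dense a<ql
                              r , rl≡c = divide 0<l c
                          in r , cancel 0<l (subst (ℚ._< _) (sym rl≡c) c<ql)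
                           , l , 0<l , xl , subst (a ℚ.<_) (sym rl≡c) a<c }
  ; ordered         = λ { {p} {q} (u , xu , pu<a) (l , 0<l , xl , a<ql) →
                          cancel (0<u xu)
                            (ℚ.<-trans pu<a (ℚ.<-trans a<ql
                              (monoʳ {q} (0<cancel 0<l (ℚ.<-trans 0<a a<ql))
                                     (ordered x xl xu)))) }
  ; located         = loc
  }
  where
  0<a : 0ℚ ℚ.< a
  0<a = ℚ.positive⁻¹ a

  A B : ℚ → Set
  B q = ∃[ u ] above x u × q ℚ.* u ℚ.< a
  A q = ∃[ l ] 0ℚ ℚ.< l × below x l × a ℚ.< q ℚ.* l

  0<u : ∀ {u} → above x u → 0ℚ ℚ.< u
  0<u = ordered x 0<x

  monoʳ : ∀ {p y z} → 0ℚ ℚ.< p → y ℚ.< z → p ℚ.* y ℚ.< p ℚ.* z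
  monoʳ {p} 0<p = ℚ.*-monoʳ-<-pos p {{ℚ.positive 0<p}}

  above-a : ∃[ b ] a ℚ.< b
  above-a = a ℚ.+ 1ℚ , subst (ℚ._< a ℚ.+ 1ℚ) (ℚ.+-identityʳ a)
                         (ℚ.+-monoʳ-< a (ℚ.positive⁻¹ 1ℚ))

  loc : ∀ {p q} → p ℚ.< q → B p ⊎ A q
  loc {p} {q} p<q with 0ℚ ℚ.<? p
  ... | no 0≮p =
    let u , xu = above-inhabited x
        pu≤0 = subst (p ℚ.* u ℚ.≤_) (ℚ.*-zeroˡ u)
                 (ℚ.*-monoʳ-≤-nonNeg u
                   {{ℚ.pos⇒nonNeg u {{ℚ.positive (0<u xu)}}}} (ℚ.≮⇒≥ 0≮p))
    in inj₁ (u , xu , ℚ.≤-<-trans pu≤0 0<a)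
  ... | yes 0<p =
    let m , p<m , m<q = ℚ.<-dense p<q
        0<m = ℚ.<-trans 0<p p<m
        0<q = ℚ.<-trans 0<m m<q
        c , cm≡a = divide 0<m a
        0<c = 0<cancel 0<m (subst (0ℚ ℚ.<_) (sym cm≡a) 0<a)
        cp<a = subst (c ℚ.* p ℚ.<_) cm≡a (monoʳ {c} 0<c p<m)
        a<cq = subst (ℚ._< c ℚ.* q) cm≡a (monoʳ {c} 0<c m<q)
        d , cp<d , d<a = ℚ.<-dense cp<a
        e , a<e , e<cq = ℚ.<-dense a<cq
        t , tp≡d = divide 0<p d
        s , sq≡e = divide 0<q e
        c<t = cancel 0<p {c} {t} (subst (c ℚ.* p ℚ.<_) (sym tp≡d) cp<d)
        s<c = cancel 0<q {s} {c} (subst (ℚ._< c ℚ.* q) (sym sq≡e) e<cq)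
        0<s = 0<cancel 0<q {s} (subst (0ℚ ℚ.<_) (sym sq≡e) (ℚ.<-trans 0<a a<e))
    in Sum.swap (Sum.map
         (λ xs → s , 0<s , xs , subst (a ℚ.<_) (trans (sym sq≡e) (ℚ.*-comm s q)) a<e)
         (λ xt → t , xt , subst (ℚ._< a) (trans (sym tp≡d) (ℚ.*-comm t p)) d<a)
         (located x (ℚ.<-trans s<c c<t)))

-- t ≤ x^y for real x ≥ 1 and y ≥ 0.  In that range x^y is the infimum of
-- p^(a/b) over rationals p > x and a/b > y, and t ≤ p^(a/b) means t^b ≤ p^a.
-- (For x < 1 this characterisation would be wrong: p^s then decreases in s.)
infix 4 _≤_^ʳ_
_≤_^ʳ_ : ℕ → ℝ → ℝ → Set
t ≤ x ^ʳ y = ∀ (p : ℚ) (a b : ℕ) .{{_ : NonZero b}} →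
  above x p → above y (+ a ℚ./ b) → fromℕ t ^ℚ b ℚ.≤ p ^ℚ a

------------------------------------------------------------------------
-- Ultra maximal graphs

-- Non-adjacent pairs are pairs of distinct vertices, so a complete graph on
-- fewer than r vertices qualifies for every ε, and K₂ has ν-bi = 1 although
-- (2/ε)^(2/ε) < 1 once ε > 2.  Any other graph can qualify only if ε ≤ 1.
UltraMaximalKFree : ∀ {n} → ℝ → ℕ → Graph n → Set
UltraMaximalKFree {n} ε r G =
  KFree r G ×
  (∀ u v → u ≢ v → ¬ Adj G u v →
    ε · n ℕ.^ (r ℕ.∸ 2) ≤ copies G (r ℕ.∸ 2) (N G u ∩ N G v))

{-# OPTIONS --safe #-}
module Submission where

open import Defs
open import Data.Nat as ℕ using (ℕ; zero; suc; _+_; _*_; _^_; _≤_; _<_; _≥_; z≤n; s≤s; NonZero)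
import Data.Nat.Properties as ℕ
open import Algebra.Properties.CommutativeSemigroup ℕ.+-commutativeSemigroup using (x∙yz≈y∙xz)
open import Data.Nat.Solver using (module +-*-Solver)
open import Data.Bool using (true; false)
open import Data.Fin using (Fin; zero; suc; _↑ˡ_; _↑ʳ_; splitAt)
import Data.Fin.Properties as Fin
open import Data.Fin.Subset using (Subset; _∈_; _∉_; _⊆_; _∩_; _∪_; ⁅_⁆; ∣_∣)
open import Data.Fin.Subset.Properties
open import Data.Vec as Vec using (Vec; _∷_; lookup; here; there)
import Data.Vec.Properties as Vec
open import Data.List using (List; []; _∷_; length; filter; map; _++_; allFin)
open import Data.Nat.ListAction using (sum)
import Data.List.Properties as List
open import Data.List.Membership.Propositional as List∈ using (find)
import Data.List.Membership.Propositional.Properties as List∈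
open import Data.List.Relation.Unary.All as All using (All; []; _∷_)
import Data.List.Relation.Unary.All.Properties as All
open import Data.List.Relation.Unary.AllPairs using ([]; _∷_)
open import Data.List.Relation.Unary.Any as Any using (Any; here; there)
open import Data.List.Relation.Unary.Unique.Propositional using (Unique)
import Data.List.Relation.Unary.Unique.Propositional.Properties as Unique
open import Data.Product using (∃-syntax; _×_; _,_; proj₁; proj₂)
open import Data.Sum using (inj₁; inj₂)
open import Data.Rational as ℚ using (ℚ; 0ℚ; 1ℚ; +-*-rawSemiring)
import Data.Rational.Properties as ℚ
import Data.Rational.Unnormalised as ℚᵘ
import Data.Rational.Unnormalised.Properties as ℚᵘ
open import Data.Integer as ℤ using (+_)
import Data.Integer.Properties as ℤ
open import Algebra.Definitions.RawSemiring +-*-rawSemiring using () renaming (_^_ to _^ℚ_)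
open import Algebra.Bundles using (CommutativeRing)
open import Algebra.Properties.CommutativeSemiring.Exp (CommutativeRing.commutativeSemiring ℚ.+-*-commutativeRing)
  using (^-assocʳ; ^-distrib-*)
open import Data.Rational.Literals using (fromℤ)
open import Data.Vec.Relation.Unary.Unique.Propositional using () renaming (Unique to VecUnique)
open import Data.Vec.Relation.Unary.Unique.Propositional.Properties using (lookup-injective)
open import Function using (_∘_; Equivalence)
open import Relation.Binary.PropositionalEquality
open import Relation.Nullary using (Dec; yes; no; ¬_; does; contradiction)
open import Relation.Nullary.Decidable using (¬?; _×-dec_; decidable-stable; dec-true)
import Relation.Unary as U

-- Work with a list I of indices of the matching and the family U(I) of k-cliques
-- (k = r − 2) lying in some N(vᵢ), i ∈ I.  Fix i ∈ I.  Since uᵢ is non-adjacent to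
-- vⱼ for the other j ∈ I, averaging over k-subsets gives a clique Q ⊆ N(uᵢ) that
-- lies in N(vⱼ) for all j in a set I′ containing an ε-fraction of I ∖ {i}.  As uᵢvᵢ
-- is an edge, some q ∈ Q is not adjacent to vᵢ, so N(q) ∩ N(vᵢ) contains ε n^k
-- k-cliques.  They belong to U(I) but not to U(I′): such a clique inside N(vⱼ) would
-- extend by q and vⱼ to a K_r.  Hence passing from I to I′ costs a factor at most
-- 2/ε in size and ε n^k elements of U, and since |U| ≤ n^k this happens at most 1/ε
-- times.  For the real ε the argument is run with a rational ℓ = c/d < ε.

-- Counting in filtered lists

private variable
  A B : Set

length-filter-mono : {P Q : A → Set} (P? : U.Decidable P) (Q? : U.Decidable Q) →
  (∀ {x} → P x → Q x) → ∀ xs → length (filter P? xs) ≤ length (filter Q? xs)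
length-filter-mono P? Q? P⇒Q [] = z≤n
length-filter-mono P? Q? P⇒Q (x ∷ xs) with length-filter-mono P? Q? P⇒Q xs | P? x | Q? x
... | ih | yes _ | yes _ = s≤s ih
... | ih | yes p | no ¬q = contradiction (P⇒Q p) ¬q
... | ih | no  _ | yes _ = ℕ.m≤n⇒m≤1+n ih
... | ih | no  _ | no  _ = ih

length-filter-disjoint : {P Q R : A → Set}
  (P? : U.Decidable P) (Q? : U.Decidable Q) (R? : U.Decidable R) →
  (∀ {x} → P x → R x) → (∀ {x} → Q x → R x) → (∀ {x} → P x → ¬ Q x) →
  ∀ xs → length (filter P? xs) + length (filter Q? xs) ≤ length (filter R? xs)
length-filter-disjoint P? Q? R? P⇒R Q⇒R P⇒¬Q [] = z≤n
length-filter-disjoint P? Q? R? P⇒R Q⇒R P⇒¬Q (x ∷ xs)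
  with length-filter-disjoint P? Q? R? P⇒R Q⇒R P⇒¬Q xs | P? x | Q? x | R? x
... | ih | yes p | yes q | _     = contradiction q (P⇒¬Q p)
... | ih | yes p | no  _ | no ¬r = contradiction (P⇒R p) ¬r
... | ih | no  _ | yes q | no ¬r = contradiction (Q⇒R q) ¬r
... | ih | yes _ | no  _ | yes _ = s≤s ih
... | ih | no  _ | yes _ | yes _ = ℕ.≤-trans (ℕ.≤-reflexive (ℕ.+-suc (length (filter P? xs)) (length (filter Q? xs)))) (s≤s ih)
... | ih | no  _ | no  _ | yes _ = ℕ.m≤n⇒m≤1+n ih
... | ih | no  _ | no  _ | no  _ = ih

nonempty : (xs : List A) → 0 < length xs → ∃[ x ] x List∈.∈ xs
nonempty (x ∷ _) _ = x , here refl

filter-filter : {P Q : A → Set} (P? : U.Decidable P) (Q? : U.Decidable Q) →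
  (∀ {x} → P x → Q x) → ∀ xs → filter P? (filter Q? xs) ≡ filter P? xs
filter-filter P? Q? P⇒Q [] = refl
filter-filter P? Q? P⇒Q (x ∷ xs) with Q? x
... | no ¬q = trans (filter-filter P? Q? P⇒Q xs) (sym (List.filter-reject P? (¬q ∘ P⇒Q)))
... | yes _ with does (P? x)
...   | true  = cong (x ∷_) (filter-filter P? Q? P⇒Q xs)
...   | false = filter-filter P? Q? P⇒Q xs

length-filter-map : (f : A → B) {P : B → Set} (P? : U.Decidable P) → ∀ xs →
  length (filter P? (map f xs)) ≡ length (filter (P? ∘ f) xs)
length-filter-map f P? [] = refl
length-filter-map f P? (x ∷ xs) with does (P? (f x))
... | true  = cong suc (length-filter-map f P? xs)
... | false = length-filter-map f P? xs

-- Double counting and averaging over a relation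

module _ {R : A → B → Set} (R? : ∀ a b → Dec (R a b)) where

  degrees : List A → List B → ℕ
  degrees as bs = sum (map (λ a → length (filter (R? a) bs)) as)

  codegrees : List A → List B → ℕ
  codegrees as bs = sum (map (λ b → length (filter (λ a → R? a b) as)) bs)

  codegrees-[] : ∀ bs → codegrees [] bs ≡ 0
  codegrees-[] []       = refl
  codegrees-[] (b ∷ bs) = codegrees-[] bs

  codegrees-∷ : ∀ a as bs → codegrees (a ∷ as) bs ≡ length (filter (R? a) bs) + codegrees as bs
  codegrees-∷ a as [] = refl
  codegrees-∷ a as (b ∷ bs) with does (R? a b)
  ... | true  = cong suc (trans (cong (f ℕ.+_) (codegrees-∷ a as bs)) (x∙yz≈y∙xz f (length (filter (R? a) bs)) _))
    where f = length (filter (λ a → R? a b) as)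
  ... | false = trans (cong (f ℕ.+_) (codegrees-∷ a as bs)) (x∙yz≈y∙xz f (length (filter (R? a) bs)) _)
    where f = length (filter (λ a → R? a b) as)

  double-counting : ∀ as bs → degrees as bs ≡ codegrees as bs
  double-counting []       bs = sym (codegrees-[] bs)
  double-counting (a ∷ as) bs = trans (cong (_ ℕ.+_) (double-counting as bs)) (sym (codegrees-∷ a as bs))

  degrees-lower : ∀ d L as bs → (∀ {a} → a List∈.∈ as → L ≤ d * length (filter (R? a) bs)) →
                  length as * L ≤ d * degrees as bs
  degrees-lower d L [] bs h = z≤n
  degrees-lower d L (a ∷ as) bs h =
    ℕ.≤-trans (ℕ.+-mono-≤ (h (here refl)) (degrees-lower d L as bs (h ∘ there)))
      (ℕ.≤-reflexive (sym (ℕ.*-distribˡ-+ d (length (filter (R? a) bs)) (degrees as bs))))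

  -- The extra summand `length bs` records the strictness: each strict inequality between naturals
  -- contributes a slack of one.
  codegrees-upper : ∀ d T as bs →
    All (λ b → d * length (filter (λ a → R? a b) as) < T) bs →
    length bs + d * codegrees as bs ≤ length bs * T
  codegrees-upper d T as [] [] = ℕ.≤-reflexive (ℕ.*-zeroʳ d)
  codegrees-upper d T as (b ∷ bs) (p ∷ ps) = begin
    suc (length bs) + d * (f + codegrees as bs)
      ≡⟨ solve 4 (λ l d f s → (con 1 :+ l) :+ d :* (f :+ s) := (con 1 :+ d :* f) :+ (l :+ d :* s)) refl (length bs) d f (codegrees as bs) ⟩
    suc (d * f) + (length bs + d * codegrees as bs)
      ≤⟨ ℕ.+-mono-≤ p (codegrees-upper d T as bs ps) ⟩
    T + length bs * T ∎
    where open ℕ.≤-Reasoning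
          open +-*-Solver
          f = length (filter (λ a → R? a b) as)

  -- Averaging. If every `b` had fewer than a c/d fraction of `as` related to it, the number of
  -- related pairs counted from `bs` would fall below the lower bound that `dense` gives when they
  -- are counted from `as`.
  popular : ∀ c d M as bs → 0 < c * M → 0 < length as → length bs ≤ M →
    (∀ {a} → a List∈.∈ as → c * M ≤ d * length (filter (R? a) bs)) →
    ∃[ b ] b List∈.∈ bs × c * length as ≤ d * length (filter (λ a → R? a b) as)
  popular c d M as bs 0<cM 0<as bs≤M dense
    with Any.any? (λ b → c * length as ℕ.≤? d * length (filter (λ a → R? a b) as)) bs
  ... | yes any = find any
  ... | no ¬any = contradiction total (ℕ.<⇒≱ (bound bs bs≤M upper))
    where
    open ℕ.≤-Reasoning
    T = c * length as
    upper : length bs + d * codegrees as bs ≤ length bs * T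
    upper = codegrees-upper d T as bs (All.map ℕ.≰⇒> (All.¬Any⇒All¬ bs ¬any))
    total : length as * (c * M) ≤ d * codegrees as bs
    total = subst (λ s → _ ≤ d * s) (double-counting as bs) (degrees-lower d (c * M) as bs dense)
    as·cM : length as * (c * M) ≡ M * T
    as·cM = +-*-Solver.solve 3 (λ a c m → a :* (c :* m) := m :* (c :* a)) refl (length as) c M
      where open +-*-Solver
    bound : ∀ bs → length bs ≤ M → length bs + d * codegrees as bs ≤ length bs * T →
            d * codegrees as bs < length as * (c * M)
    -- For empty `bs` the slack `length bs` is zero, so the strict inequality comes from
    -- `0 < length as` and `0 < c * M` instead.
    bound [] _ h = ℕ.≤-<-trans h (ℕ.*-mono-< 0<as 0<cM)
    bound bs@(_ ∷ _) le h = begin-strict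
      d * codegrees as bs               <⟨ ℕ.m<n+m _ (s≤s z≤n) ⟩
      length bs + d * codegrees as bs   ≤⟨ h ⟩
      length bs * T                     ≤⟨ ℕ.*-monoˡ-≤ T le ⟩
      M * T                             ≡⟨ as·cM ⟨
      length as * (c * M)               ∎

-- The number of k-subsets

∣_∣≡?_ : ∀ {n} (S : Subset n) k → Dec (∣ S ∣ ≡ k)
∣ S ∣≡? k = ∣ S ∣ ℕ.≟ k

-- Pascal's recursion on the first element, with n^k + n · n^k = (n + 1) n^k ≤ (n + 1)^(k + 1). The
-- crude n^k in place of a binomial coefficient fits, as ultra maximality is normalised by the same
-- power.
count-subsets : ∀ n k → length (filter (λ S → ∣ S ∣≡? k) (subsets n)) ≤ n ^ k
count-subsets zero zero = s≤s z≤n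
count-subsets zero (suc k) = z≤n
count-subsets (suc n) k = begin
  length (filter P? (map (true ∷_) (subsets n) ++ map (false ∷_) (subsets n)))
    ≡⟨ cong length (List.filter-++ P? (map (true ∷_) (subsets n)) _) ⟩
  length (filter P? (map (true ∷_) (subsets n)) ++ filter P? (map (false ∷_) (subsets n)))
    ≡⟨ List.length-++ (filter P? (map (true ∷_) (subsets n))) ⟩
  length (filter P? (map (true ∷_) (subsets n))) + length (filter P? (map (false ∷_) (subsets n)))
    ≡⟨ cong₂ _+_ (length-filter-map (true ∷_) P? (subsets n)) (length-filter-map (false ∷_) P? (subsets n)) ⟩
  length (filter (P? ∘ (true ∷_)) (subsets n)) + length (filter (λ S → ∣ S ∣≡? k) (subsets n))
    ≤⟨ step k ⟩
  suc n ^ k ∎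
  where
  open ℕ.≤-Reasoning
  P? : ∀ {m} → U.Decidable (λ (S : Subset m) → ∣ S ∣ ≡ k)
  P? S = ∣ S ∣≡? k
  step : ∀ k → length (filter (λ S → ∣ true ∷ S ∣≡? k) (subsets n)) +
               length (filter (λ S → ∣ S ∣≡? k) (subsets n)) ≤ suc n ^ k
  step zero = ℕ.≤-trans
    (ℕ.+-monoˡ-≤ (length (filter (λ S → ∣ S ∣≡? 0) (subsets n)))
      (ℕ.≤-reflexive (cong length (List.filter-none (λ S → ∣ true ∷ S ∣≡? 0) (All.universal (λ _ ()) (subsets n))))))
    (count-subsets n 0)
  step (suc k) = begin
    length (filter (λ S → ∣ true ∷ S ∣≡? suc k) (subsets n)) + length (filter (λ S → ∣ S ∣≡? suc k) (subsets n))
      ≤⟨ ℕ.+-mono-≤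
           (ℕ.≤-trans (length-filter-mono (λ S → ∣ true ∷ S ∣≡? suc k) (λ S → ∣ S ∣≡? k) ℕ.suc-injective (subsets n))
                      (count-subsets n k))
           (count-subsets n (suc k)) ⟩
    n ^ k + n * n ^ k   ≤⟨ ℕ.*-monoʳ-≤ (suc n) (ℕ.^-monoˡ-≤ k (ℕ.n≤1+n n)) ⟩
    suc n ^ suc k       ∎

-- Neighbourhoods and extension of cliques

∣p∪⁅x⁆∣ : ∀ {n} (p : Subset n) {x} → x ∉ p → ∣ p ∪ ⁅ x ⁆ ∣ ≡ suc ∣ p ∣
∣p∪⁅x⁆∣ (true  ∷ p) {zero}  x∉p = contradiction here x∉p
∣p∪⁅x⁆∣ (false ∷ p) {zero}  x∉p = cong (suc ∘ ∣_∣) (∪-identityʳ p)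
∣p∪⁅x⁆∣ (true  ∷ p) {suc x} x∉p = cong suc (∣p∪⁅x⁆∣ p (x∉p ∘ there))
∣p∪⁅x⁆∣ (false ∷ p) {suc x} x∉p = ∣p∪⁅x⁆∣ p (x∉p ∘ there)

module _ {n} (G : Graph n) where

  ∈N⇒Adj : ∀ {u x} → x ∈ N G u → Adj G u x
  ∈N⇒Adj {u} {x} x∈N with adj? G u x in eq
  ... | yes a = a
  ... | no  _ with () ← trans (sym (cong does eq))
                (trans (sym (Vec.lookup∘tabulate (does ∘ adj? G u) x)) (Vec.[]=⇒lookup x∈N))

  Adj⇒∈N : ∀ {u x} → Adj G u x → x ∈ N G u
  Adj⇒∈N {u} {x} a = Vec.lookup⇒[]= x _
    (trans (Vec.lookup∘tabulate (does ∘ adj? G u) x) (dec-true (adj? G u x) a))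

  extend-clique : ∀ {S x} → IsClique G S → S ⊆ N G x →
                  IsClique G (S ∪ ⁅ x ⁆) × ∣ S ∪ ⁅ x ⁆ ∣ ≡ suc ∣ S ∣
  extend-clique {S} {x} clique S⊆N = clique′ , ∣p∪⁅x⁆∣ S (irrefl G refl ∘ ∈N⇒Adj ∘ S⊆N)
    where
    clique′ : IsClique G (S ∪ ⁅ x ⁆)
    clique′ y z y∈ z∈ y≢z with x∈p∪q⁻ S ⁅ x ⁆ y∈ | x∈p∪q⁻ S ⁅ x ⁆ z∈
    ... | inj₁ y∈S | inj₁ z∈S = clique y z y∈S z∈S y≢z
    ... | inj₁ y∈S | inj₂ z∈x with refl ← x∈⁅y⁆⇒x≡y x z∈x = symm G (∈N⇒Adj (S⊆N y∈S))
    ... | inj₂ y∈x | inj₁ z∈S with refl ← x∈⁅y⁆⇒x≡y x y∈x = ∈N⇒Adj (S⊆N z∈S)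
    ... | inj₂ y∈x | inj₂ z∈x = contradiction (trans (x∈⁅y⁆⇒x≡y x y∈x) (sym (x∈⁅y⁆⇒x≡y x z∈x))) y≢z

  -- A k-clique in both neighbourhoods would extend by x and then by y to a clique on 2 + k
  -- vertices.
  edge-common-clique-free : ∀ {k x y S} → KFree (2 + k) G → Adj G x y → ∣ S ∣ ≡ k →
    IsClique G S → S ⊆ N G x → ¬ S ⊆ N G y
  edge-common-clique-free {x = x} {y} {S} free xy ∣S∣≡k clique S⊆Nx S⊆Ny =
    let clique₁ , size₁ = extend-clique clique S⊆Nx
        clique₂ , size₂ = extend-clique clique₁ S∪x⊆Ny
    in free _ (trans size₂ (cong suc (trans size₁ (cong suc ∣S∣≡k)))) clique₂
    where
    S∪x⊆Ny : S ∪ ⁅ x ⁆ ⊆ N G y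
    S∪x⊆Ny z∈ with x∈p∪q⁻ S ⁅ x ⁆ z∈
    ... | inj₁ z∈S = S⊆Ny z∈S
    ... | inj₂ z∈x with refl ← x∈⁅y⁆⇒x≡y x z∈x = Adj⇒∈N (symm G xy)

  copies-mono : ∀ k {S T} → S ⊆ T → copies G k S ≤ copies G k T
  copies-mono k {S} {T} S⊆T = length-filter-mono (isCopy? G k S) (isCopy? G k T)
    (λ (size , Q⊆S , clique) → size , S⊆T ∘ Q⊆S , clique) (subsets n)

-- Shrinking the matching, with c/d in the role of ε

module _ {n t} (G : Graph n) (k c d : ℕ) (u v : Fin t → Fin n)
  (0<c : 0 < c) (0<n^k : 0 < n ^ k) (free : KFree (2 + k) G)
  (dense : ∀ x y → x ≢ y → ¬ Adj G x y → c * n ^ k ≤ d * copies G k (N G x ∩ N G y))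
  (matched : ∀ i → Adj G (u i) (v i))
  (unmatched : ∀ {i j} → i ≢ j → ¬ Adj G (u i) (v j))
  (disjoint : ∀ i j → u i ≢ v j)
  where

  private
    M = n ^ k

  -- This is membership in the family U(I); `covered I` is the size of that family.
  Covered : List (Fin t) → Subset n → Set
  Covered I S = Any (λ i → IsCopy G k (N G (v i)) S) I

  covered? : ∀ I → U.Decidable (Covered I)
  covered? I S = Any.any? (λ i → isCopy? G k (N G (v i)) S) I

  covered : List (Fin t) → ℕ
  covered I = length (filter (covered? I) (subsets n))

  covered≤n^k : ∀ I → covered I ≤ M
  covered≤n^k I = ℕ.≤-trans
    (length-filter-mono (covered? I) (λ S → ∣ S ∣≡? k) (proj₁ ∘ proj₂ ∘ Any.satisfied) (subsets n))
    (count-subsets n k)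

  -- q = vᵢ is possible here, and then ultra maximality is applied to uⱼ and vᵢ instead.
  dense-around : ∀ {i j} q → i ≢ j → ¬ Adj G q (v i) → c * M ≤ d * copies G k (N G q ∩ N G (v i))
  dense-around {i} {j} q i≢j ¬qv with q Fin.≟ v i
  ... | no q≢v = dense q (v i) q≢v ¬qv
  ... | yes refl = ℕ.≤-trans (dense (u j) (v i) (disjoint j i) (unmatched (i≢j ∘ sym)))
    (ℕ.*-monoʳ-≤ d (copies-mono G k λ x∈ → let x∈v = p∩q⊆q (N G (u j)) (N G (v i)) x∈ in x∈p∩q⁺ (x∈v , x∈v)))

  -- The gain of one round. The copies in N(q) ∩ N(vᵢ), for a suitable q ∈ Q, are covered by `i ∷ J`
  -- through i and are disjoint from the family of `I`. The index j supplies the vertex uⱼ for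
  -- `dense-around` in case q = vᵢ.
  uncover : ∀ {i j I J Q} → i ≢ j → IsCopy G k (N G (u i)) Q →
    (∀ {x} → x List∈.∈ I → x List∈.∈ J × Q ⊆ N G (v x)) →
    c * M + d * covered I ≤ d * covered (i ∷ J)
  uncover {i} {j} {I} {J} {Q} i≢j (∣Q∣≡k , Q⊆Nuᵢ , clique) member =
    gain (Fin.any? λ q → (q ∈? Q) ×-dec ¬? (adj? G q (v i)))
    where
    open ℕ.≤-Reasoning
    gain : Dec (∃[ q ] q ∈ Q × ¬ Adj G q (v i)) → c * M + d * covered I ≤ d * covered (i ∷ J)
    -- If all of Q were adjacent to vᵢ, then Q would be a k-clique in both neighbourhoods of the
    -- edge uᵢvᵢ.
    gain (no none) = contradiction
      (λ {q} q∈Q → Adj⇒∈N G (symm G (decidable-stable (adj? G q (v i)) λ ¬qv → none (q , q∈Q , ¬qv))))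
      (edge-common-clique-free G {S = Q} free (matched i) ∣Q∣≡k clique Q⊆Nuᵢ)
    gain (yes (q , q∈Q , ¬qv)) = begin
      c * M + d * covered I
        ≤⟨ ℕ.+-monoˡ-≤ (d * covered I) (dense-around q i≢j ¬qv) ⟩
      d * copies G k W + d * covered I
        ≡⟨ ℕ.*-distribˡ-+ d (copies G k W) (covered I) ⟨
      d * (copies G k W + covered I)
        ≤⟨ ℕ.*-monoʳ-≤ d (length-filter-disjoint (isCopy? G k W) (covered? I) (covered? (i ∷ J))
             (λ (size , S⊆W , cl) → here (size , p∩q⊆q (N G q) (N G (v i)) ∘ S⊆W , cl))
             (λ cov → let x , x∈I , copy = find cov in there (List∈.lose (proj₁ (member x∈I)) copy))
             apart (subsets n)) ⟩
      d * covered (i ∷ J) ∎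
      where
      W = N G q ∩ N G (v i)
      -- Since q ∈ Q ⊆ N(vₓ), the pair q, vₓ is an edge, and S would lie in both of its
      -- neighbourhoods.
      apart : ∀ {S} → IsCopy G k W S → ¬ Covered I S
      apart {S} (size , S⊆W , cl) cov =
        let x , x∈I , (_ , S⊆Nvₓ , _) = find cov
            Q⊆Nvₓ = proj₂ (member x∈I)
        in edge-common-clique-free G {S = S} free (symm G (∈N⇒Adj G (Q⊆Nvₓ q∈Q))) size cl
             (p∩q⊆p (N G q) (N G (v i)) ∘ S⊆W) S⊆Nvₓ

  -- One round: `popular` is applied to the relation "Q is a k-clique in N(uᵢ) ∩ N(vⱼ)", and the new
  -- list consists of the j ∈ J related to the popular Q.
  shrink : ∀ i J → 0 < length J → Unique (i ∷ J) →
    ∃[ I ] Unique I × length I ≤ length J × c * length J ≤ d * length I ×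
           c * M + d * covered I ≤ d * covered (i ∷ J)
  shrink i J 0<J (i∉J ∷ uniqJ) =
    let Q , _ , c∣J∣≤d∣I∣ = popular R? c d M J candidates (ℕ.*-mono-< 0<c 0<n^k) 0<J (count-subsets n k) dense-u
        P? = λ j → R? j Q
        -- The averaging alone does not say that Q is a clique in N(uᵢ); a member of the new list
        -- certifies it. One exists because c · |J| > 0.
        j , j∈I = nonempty (filter P? J)
          (ℕ.n≢0⇒n>0 λ I≡0 → ℕ.<⇒≱ (ℕ.*-mono-< 0<c 0<J)
            (ℕ.≤-trans c∣J∣≤d∣I∣ (ℕ.≤-reflexive (trans (cong (d *_) I≡0) (ℕ.*-zeroʳ d)))))
        j∈J , (∣Q∣≡k , Q⊆ , clique) = List∈.∈-filter⁻ P? {xs = J} j∈I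
    in filter P? J , Unique.filter⁺ P? uniqJ , List.length-filter P? J , c∣J∣≤d∣I∣ ,
       uncover (All.lookup i∉J j∈J) (∣Q∣≡k , p∩q⊆p (N G (u i)) (N G (v j)) ∘ Q⊆ , clique)
         (λ {x} x∈I → let x∈J , (_ , Q⊆ₓ , _) = List∈.∈-filter⁻ P? {xs = J} x∈I
                      in x∈J , p∩q⊆q (N G (u i)) (N G (v x)) ∘ Q⊆ₓ)
    where
    R? : ∀ j Q → Dec (IsCopy G k (N G (u i) ∩ N G (v j)) Q)
    R? j Q = isCopy? G k (N G (u i) ∩ N G (v j)) Q
    -- Restricting to k-sets keeps the list within n^k, as the averaging requires; by
    -- `filter-filter` no copy is lost.
    candidates = filter (λ S → ∣ S ∣≡? k) (subsets n)
    dense-u : ∀ {j} → j List∈.∈ J → c * M ≤ d * length (filter (R? j) candidates)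
    dense-u {j} j∈J = ℕ.≤-trans (dense (u i) (v j) (disjoint i j) (unmatched (All.lookup i∉J j∈J)))
      (ℕ.≤-reflexive (cong (λ l → d * length l) (sym (filter-filter (R? j) (λ S → ∣ S ∣≡? k) proj₁ (subsets n)))))

  -- Here e counts the rounds until at most one index is left. The bound m on the length drives the
  -- recursion, because the list returned by `shrink` is not structurally smaller.
  iterate-shrink : ∀ m I → Unique I → length I ≤ m →
    ∃[ e ] c ^ e * length I ≤ (2 * d) ^ e × e * (c * M) ≤ d * covered I
  iterate-shrink m [] _ _ = 0 , z≤n , z≤n
  iterate-shrink m (i ∷ []) _ _ = 0 , s≤s z≤n , z≤n
  iterate-shrink (suc m) (i ∷ J@(_ ∷ J′)) uniq (s≤s J≤m)
    with I , uniqI , I≤J , c∣J∣≤d∣I∣ , gain ← shrink i J (s≤s z≤n) uniq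
    with e , size , weight ← iterate-shrink m I uniqI (ℕ.≤-trans I≤J J≤m)
    = suc e , size′ , ℕ.≤-trans (ℕ.+-monoʳ-≤ (c * M) weight) gain
    where
    open ℕ.≤-Reasoning
    open +-*-Solver
    size′ : c ^ suc e * length (i ∷ J) ≤ (2 * d) ^ suc e
    size′ = begin
      -- As `J` is nonempty, 1 + |J| ≤ 2|J|. This absorbs the removed index i and is the source of
      -- the 2 in the base 2/ε.
      c * c ^ e * (1 + length J)             ≤⟨ ℕ.*-monoʳ-≤ (c * c ^ e) (s≤s (ℕ.m≤n+m (length J) (length J′))) ⟩
      c * c ^ e * (length J + length J)      ≡⟨ solve 3 (λ c x j → c :* x :* (j :+ j) := con 2 :* x :* (c :* j)) refl c (c ^ e) (length J) ⟩
      2 * c ^ e * (c * length J)             ≤⟨ ℕ.*-monoʳ-≤ (2 * c ^ e) c∣J∣≤d∣I∣ ⟩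
      2 * c ^ e * (d * length I)             ≡⟨ solve 3 (λ x d l → con 2 :* x :* (d :* l) := con 2 :* d :* (x :* l)) refl (c ^ e) d (length I) ⟩
      2 * d * (c ^ e * length I)             ≤⟨ ℕ.*-monoʳ-≤ (2 * d) size ⟩
      (2 * d) ^ suc e                        ∎

  -- Starting from all t indices, the e rounds gain e · c · n^k in total, while d times the size of
  -- U never exceeds d · n^k; cancelling n^k bounds e by d/c.
  matching-bound : ∃[ e ] c ^ e * t ≤ (2 * d) ^ e × e * c ≤ d
  matching-bound with e , size , weight ← iterate-shrink t (allFin t) (Unique.allFin⁺ t) (ℕ.≤-reflexive (List.length-tabulate _))
    = e , subst (λ l → c ^ e * l ≤ _) (List.length-tabulate _) size
        , ℕ.*-cancelʳ-≤ (e * c) d M {{ℕ.>-nonZero 0<n^k}} (begin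
            e * c * M     ≡⟨ ℕ.*-assoc e c M ⟩
            e * (c * M)   ≤⟨ weight ⟩
            d * covered (allFin t)     ≤⟨ ℕ.*-monoʳ-≤ d (covered≤n^k (allFin t)) ⟩
            d * M ∎)
    where open ℕ.≤-Reasoning

-- Naturals, fractions and powers in the rationals

fromℤ-cancel-≤ : ∀ {i j} → fromℤ i ℚ.≤ fromℤ j → i ℤ.≤ j
fromℤ-cancel-≤ (ℚ.*≤* i≤j) = subst₂ ℤ._≤_ (ℤ.*-identityʳ _) (ℤ.*-identityʳ _) i≤j

fromℕ-cancel-≤ : ∀ {m n} → fromℕ m ℚ.≤ fromℕ n → m ≤ n
fromℕ-cancel-≤ = ℤ.drop‿+≤+ ∘ fromℤ-cancel-≤

fromℕ-mono-≤ : ∀ {m n} → m ≤ n → fromℕ m ℚ.≤ fromℕ n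
fromℕ-mono-≤ m≤n = ℚ.*≤* (ℤ.*-monoʳ-≤-nonNeg (+ 1) (ℤ.+≤+ m≤n))

fromℕ-mono-< : ∀ {m n} → m < n → fromℕ m ℚ.< fromℕ n
fromℕ-mono-< m<n = ℚ.*<* (ℤ.*-monoʳ-<-pos (+ 1) (ℤ.+<+ m<n))

fromℕ-* : ∀ m n → fromℕ (m * n) ≡ fromℕ m ℚ.* fromℕ n
fromℕ-* m n = ℚ.toℚᵘ-injective (ℚᵘ.≃-trans
  (ℚᵘ.*≡* (cong (ℤ._* + 1) (ℤ.pos-* m n)))
  (ℚᵘ.≃-sym (ℚ.toℚᵘ-homo-* (fromℕ m) (fromℕ n))))

fromℕ-^ : ∀ m n → fromℕ (m ^ n) ≡ fromℕ m ^ℚ n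
fromℕ-^ m zero    = refl
fromℕ-^ m (suc n) = trans (fromℕ-* m (m ^ n)) (cong (fromℕ m ℚ.*_) (fromℕ-^ m n))

i/n*n≡i : ∀ i n .{{_ : NonZero n}} → (i ℚ./ n) ℚ.* fromℕ n ≡ fromℤ i
i/n*n≡i i n@(suc m) = ℚ.toℚᵘ-injective (begin
  ℚ.toℚᵘ ((i ℚ./ n) ℚ.* fromℕ n)                ≈⟨ ℚ.toℚᵘ-homo-* (i ℚ./ n) (fromℕ n) ⟩
  ℚ.toℚᵘ (i ℚ./ n) ℚᵘ.* ℚᵘ.mkℚᵘ (+ n) 0         ≈⟨ ℚᵘ.*-congʳ (ℚ.toℚᵘ-fromℚᵘ (ℚᵘ.mkℚᵘ i m)) ⟩
  ℚᵘ.mkℚᵘ i m ℚᵘ.* ℚᵘ.mkℚᵘ (+ n) 0              ≈⟨ ℚᵘ.*≡* (trans (ℤ.*-assoc i (+ n) (+ 1)) (cong (i ℤ.*_) (ℤ.pos-* n 1))) ⟩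
  ℚᵘ.mkℚᵘ i 0 ∎)
  where open import Relation.Binary.Reasoning.Setoid ℚᵘ.≃-setoid

positive-fraction : ∀ {q} → 0ℚ ℚ.< q → ∃[ c ] ∃[ d ] 0 < c × q ℚ.* fromℕ d ≡ fromℕ c
positive-fraction {q@(ℚ.mkℚ (+ suc c) d-1 _)} _ = suc c , suc d-1 , s≤s z≤n ,
  trans (cong (ℚ._* fromℕ (suc d-1)) (sym (ℚ.↥p/↧p≡p q))) (i/n*n≡i (+ suc c) (suc d-1))
positive-fraction {ℚ.mkℚ (+ zero) _ _} 0<q with () ← ℚ.positive 0<q
positive-fraction {ℚ.mkℚ (ℤ.-[1+ _ ]) _ _} 0<q with () ← ℚ.positive 0<q

*-mono-≤-nonNeg : ∀ {p q r s} → 0ℚ ℚ.≤ q → 0ℚ ℚ.≤ r → p ℚ.≤ q → r ℚ.≤ s → p ℚ.* r ℚ.≤ q ℚ.* s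
*-mono-≤-nonNeg {q = q} {r} 0≤q 0≤r p≤q r≤s = ℚ.≤-trans
  (ℚ.*-monoʳ-≤-nonNeg r {{ℚ.nonNegative 0≤r}} p≤q) (ℚ.*-monoˡ-≤-nonNeg q {{ℚ.nonNegative 0≤q}} r≤s)

0≤1 : 0ℚ ℚ.≤ 1ℚ
0≤1 = ℚ.nonNegative⁻¹ 1ℚ

^-nonNeg : ∀ {p} → 0ℚ ℚ.≤ p → ∀ n → 0ℚ ℚ.≤ p ^ℚ n
^-nonNeg 0≤p zero    = 0≤1
^-nonNeg {p} 0≤p (suc n) = ℚ.nonNegative⁻¹ _
  {{ℚ.nonNeg*nonNeg⇒nonNeg p {{ℚ.nonNegative 0≤p}} _ {{ℚ.nonNegative (^-nonNeg 0≤p n)}}}}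

^-monoˡ-≤ : ∀ {p q} → 0ℚ ℚ.≤ p → p ℚ.≤ q → ∀ n → p ^ℚ n ℚ.≤ q ^ℚ n
^-monoˡ-≤ 0≤p p≤q zero    = ℚ.≤-refl
^-monoˡ-≤ 0≤p p≤q (suc n) = *-mono-≤-nonNeg (ℚ.≤-trans 0≤p p≤q) (^-nonNeg 0≤p n) p≤q (^-monoˡ-≤ 0≤p p≤q n)

^-monoʳ-≤ : ∀ {p m n} → 1ℚ ℚ.≤ p → m ≤ n → p ^ℚ m ℚ.≤ p ^ℚ n
^-monoʳ-≤ {n = zero}  1≤p z≤n = ℚ.≤-refl
^-monoʳ-≤ {n = suc n} 1≤p z≤n =
  *-mono-≤-nonNeg {p = 1ℚ} {r = 1ℚ} (ℚ.≤-trans 0≤1 1≤p) 0≤1 1≤p (^-monoʳ-≤ {n = n} 1≤p z≤n)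
^-monoʳ-≤ {p} 1≤p (s≤s m≤n) = ℚ.*-monoˡ-≤-nonNeg p {{ℚ.nonNegative (ℚ.≤-trans 0≤1 1≤p)}} (^-monoʳ-≤ 1≤p m≤n)

fromℕ-nonNeg : ∀ n → 0ℚ ℚ.≤ fromℕ n
fromℕ-nonNeg n = fromℕ-mono-≤ z≤n

clear-denominator : ∀ ℓ c d → ℓ ℚ.* fromℕ d ≡ fromℕ c → ∀ m x → ℓ ℚ.* fromℕ m ℚ.≤ fromℕ x → c * m ≤ d * x
clear-denominator ℓ c d ℓd≡c m x ℓm≤x = fromℕ-cancel-≤ (begin
  fromℕ (c * m)                    ≡⟨ fromℕ-* c m ⟩
  fromℕ c ℚ.* fromℕ m              ≡⟨ cong (ℚ._* fromℕ m) (trans (sym ℓd≡c) (ℚ.*-comm ℓ (fromℕ d))) ⟩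
  fromℕ d ℚ.* ℓ ℚ.* fromℕ m        ≡⟨ ℚ.*-assoc (fromℕ d) ℓ (fromℕ m) ⟩
  fromℕ d ℚ.* (ℓ ℚ.* fromℕ m)      ≤⟨ ℚ.*-monoˡ-≤-nonNeg (fromℕ d) {{ℚ.nonNegative (fromℕ-nonNeg d)}} ℓm≤x ⟩
  fromℕ d ℚ.* fromℕ x              ≡⟨ fromℕ-* d x ⟨
  fromℕ (d * x)                    ∎)
  where open ℚ.≤-Reasoning

-- From the integer bounds to rational powers, with ℓ = c/d

module _ {p ℓ : ℚ} {c d : ℕ} (0<c : 0 < c) (ℓd≡c : ℓ ℚ.* fromℕ d ≡ fromℕ c)
  (0<ℓ : 0ℚ ℚ.< ℓ) (ℓ≤2 : ℓ ℚ.≤ fromℕ 2) (2<pℓ : fromℕ 2 ℚ.< p ℚ.* ℓ) where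

  private
    instance
      pos-ℓ : ℚ.Positive ℓ
      pos-ℓ = ℚ.positive 0<ℓ

  -- The place where ε ≤ 2 enters: p < 1 would give pℓ < ℓ ≤ 2 < pℓ. It makes powers of p monotone
  -- in the exponent.
  1≤p : 1ℚ ℚ.≤ p
  1≤p = ℚ.≮⇒≥ λ p<1 → ℚ.<-irrefl refl (ℚ.<-≤-trans
    (ℚ.<-trans 2<pℓ (ℚ.*-monoˡ-<-pos ℓ p<1)) (ℚ.≤-trans (ℚ.≤-reflexive (ℚ.*-identityˡ ℓ)) ℓ≤2))

  2d≤cp : fromℕ (2 * d) ℚ.≤ fromℕ c ℚ.* p
  2d≤cp = begin
    fromℕ (2 * d)                ≡⟨ fromℕ-* 2 d ⟩
    fromℕ 2 ℚ.* fromℕ d          ≤⟨ ℚ.*-monoʳ-≤-nonNeg (fromℕ d) {{ℚ.nonNegative (fromℕ-nonNeg d)}} (ℚ.<⇒≤ 2<pℓ) ⟩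
    p ℚ.* ℓ ℚ.* fromℕ d          ≡⟨ ℚ.*-assoc p ℓ (fromℕ d) ⟩
    p ℚ.* (ℓ ℚ.* fromℕ d)        ≡⟨ cong (p ℚ.*_) ℓd≡c ⟩
    p ℚ.* fromℕ c                ≡⟨ ℚ.*-comm p (fromℕ c) ⟩
    fromℕ c ℚ.* p                ∎
    where open ℚ.≤-Reasoning

  -- The base satisfies 2d/c = 2/ℓ < p; instead of dividing, the factor c^e is cancelled at the end.
  base-bound : ∀ e {t} → c ^ e * t ≤ (2 * d) ^ e → fromℕ t ℚ.≤ p ^ℚ e
  base-bound e {t} bound = ℚ.*-cancelˡ-≤-pos (fromℕ (c ^ e)) {{ℚ.positive (fromℕ-mono-< (ℕ.m^n>0 c {{ℕ.>-nonZero 0<c}} e))}} (begin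
    fromℕ (c ^ e) ℚ.* fromℕ t    ≡⟨ fromℕ-* (c ^ e) t ⟨
    fromℕ (c ^ e * t)            ≤⟨ fromℕ-mono-≤ bound ⟩
    fromℕ ((2 * d) ^ e)          ≡⟨ fromℕ-^ (2 * d) e ⟩
    fromℕ (2 * d) ^ℚ e           ≤⟨ ^-monoˡ-≤ (fromℕ-nonNeg (2 * d)) 2d≤cp e ⟩
    (fromℕ c ℚ.* p) ^ℚ e         ≡⟨ ^-distrib-* (fromℕ c) p e ⟩
    fromℕ c ^ℚ e ℚ.* p ^ℚ e      ≡⟨ cong (ℚ._* p ^ℚ e) (fromℕ-^ c e) ⟨
    fromℕ (c ^ e) ℚ.* p ^ℚ e     ∎)
    where open ℚ.≤-Reasoning

  -- Multiplying 2 < (a/b)ℓ by d · b clears both denominators, because (a/b) · b = a and ℓ · d = c.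
  2db≤ac : ∀ a b .{{_ : NonZero b}} → fromℕ 2 ℚ.< (+ a ℚ./ b) ℚ.* ℓ → 2 * (d * b) ≤ a * c
  2db≤ac a b 2<aℓ/b = fromℕ-cancel-≤ (begin
    fromℕ (2 * (d * b))                             ≡⟨ fromℕ-* 2 (d * b) ⟩
    fromℕ 2 ℚ.* fromℕ (d * b)
      ≤⟨ ℚ.*-monoʳ-≤-nonNeg (fromℕ (d * b)) {{ℚ.nonNegative (fromℕ-nonNeg (d * b))}} (ℚ.<⇒≤ 2<aℓ/b) ⟩
    (+ a ℚ./ b) ℚ.* ℓ ℚ.* fromℕ (d * b)
      ≡⟨ cong ((+ a ℚ./ b) ℚ.* ℓ ℚ.*_) (trans (cong fromℕ (ℕ.*-comm d b)) (fromℕ-* b d)) ⟩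
    (+ a ℚ./ b) ℚ.* ℓ ℚ.* (fromℕ b ℚ.* fromℕ d)     ≡⟨ interchange (+ a ℚ./ b) ℓ (fromℕ b) (fromℕ d) ⟩
    (+ a ℚ./ b) ℚ.* fromℕ b ℚ.* (ℓ ℚ.* fromℕ d)     ≡⟨ cong₂ ℚ._*_ (i/n*n≡i (+ a) b) ℓd≡c ⟩
    fromℕ a ℚ.* fromℕ c                             ≡⟨ fromℕ-* a c ⟨
    fromℕ (a * c)                                   ∎)
    where
    open ℚ.≤-Reasoning
    open CommutativeRing ℚ.+-*-commutativeRing using (*-commutativeSemigroup)
    open import Algebra.Properties.CommutativeSemigroup *-commutativeSemigroup using (interchange)

  -- The number of rounds is at most d/c = 1/ℓ, hence at most 2/ℓ < a/b.
  exponent-bound : ∀ e a b .{{_ : NonZero b}} → e * c ≤ d → fromℕ 2 ℚ.< (+ a ℚ./ b) ℚ.* ℓ → e * b ≤ a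
  exponent-bound e a b ec≤d 2<aℓ/b = ℕ.*-cancelʳ-≤ (e * b) a c {{ℕ.>-nonZero 0<c}} (begin
    e * b * c        ≡⟨ solve 3 (λ e b c → e :* b :* c := e :* c :* b) refl e b c ⟩
    e * c * b        ≤⟨ ℕ.*-monoˡ-≤ b ec≤d ⟩
    d * b            ≤⟨ ℕ.m≤n*m (d * b) 2 ⟩
    2 * (d * b)      ≤⟨ 2db≤ac a b 2<aℓ/b ⟩
    a * c            ∎)
    where
    open ℕ.≤-Reasoning
    open +-*-Solver

  power-bound : ∀ e {t} a b .{{_ : NonZero b}} → c ^ e * t ≤ (2 * d) ^ e → e * c ≤ d →
    fromℕ 2 ℚ.< (+ a ℚ./ b) ℚ.* ℓ → fromℕ t ^ℚ b ℚ.≤ p ^ℚ a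
  power-bound e {t} a b bound ec≤d 2<aℓ/b = begin
    fromℕ t ^ℚ b        ≤⟨ ^-monoˡ-≤ (fromℕ-nonNeg t) (base-bound e bound) b ⟩
    (p ^ℚ e) ^ℚ b       ≡⟨ ^-assocʳ p e b ⟩
    p ^ℚ (e * b)        ≤⟨ ^-monoʳ-≤ 1≤p (exponent-bound e a b ec≤d 2<aℓ/b) ⟩
    p ^ℚ a              ∎
    where open ℚ.≤-Reasoning

-- Choosing the rational ℓ below ε

-- The factor x is nonnegative because its product with ℓ > 0 exceeds a positive number, so
-- enlarging ℓ preserves the inequality.
raise : ∀ {a ℓ ℓ′} x → 0ℚ ℚ.< ℓ → 0ℚ ℚ.< a → a ℚ.< x ℚ.* ℓ → ℓ ℚ.≤ ℓ′ → a ℚ.< x ℚ.* ℓ′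
raise {a} {ℓ} x 0<ℓ 0<a a<xℓ ℓ≤ℓ′ = ℚ.<-≤-trans a<xℓ (ℚ.*-monoˡ-≤-nonNeg x {{ℚ.nonNegative 0≤x}} ℓ≤ℓ′)
  where
  0≤x : 0ℚ ℚ.≤ x
  0≤x = ℚ.*-cancelʳ-≤-pos ℓ {{ℚ.positive 0<ℓ}}
    (subst (ℚ._≤ x ℚ.* ℓ) (sym (ℚ.*-zeroˡ ℓ)) (ℚ.<⇒≤ (ℚ.<-trans 0<a a<xℓ)))

-- The base and the exponent each lie above 2/ε by virtue of their own rational below ε; the larger
-- of the two serves both.
common-witness : ∀ (ε : ℝ) {a a′} x y → 0ℚ ℚ.< a → 0ℚ ℚ.< a′ →
  ∃[ ℓ ] 0ℚ ℚ.< ℓ × below ε ℓ × a ℚ.< x ℚ.* ℓ → ∃[ ℓ ] 0ℚ ℚ.< ℓ × below ε ℓ × a′ ℚ.< y ℚ.* ℓ →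
  ∃[ ℓ ] 0ℚ ℚ.< ℓ × below ε ℓ × a ℚ.< x ℚ.* ℓ × a′ ℚ.< y ℚ.* ℓ
common-witness ε x y 0<a 0<a′ (ℓ₁ , 0<ℓ₁ , εℓ₁ , a<) (ℓ₂ , 0<ℓ₂ , εℓ₂ , a′<) with ℚ.≤-total ℓ₁ ℓ₂
... | inj₁ ℓ₁≤ℓ₂ = ℓ₂ , 0<ℓ₂ , εℓ₂ , raise x 0<ℓ₁ 0<a a< ℓ₁≤ℓ₂ , a′<
... | inj₂ ℓ₂≤ℓ₁ = ℓ₁ , 0<ℓ₁ , εℓ₁ , a< , raise y 0<ℓ₂ 0<a′ a′< ℓ₂≤ℓ₁

-- The bound for a maximum matching

matching-disjoint : ∀ {n t} (u v : Vec (Fin n) t) → VecUnique (u Vec.++ v) →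
                    ∀ i j → lookup u i ≢ lookup v j
matching-disjoint {t = t} u v distinct i j uᵢ≡vⱼ = contradiction inj₁≡inj₂ λ ()
  where
  i≡j : i ↑ˡ t ≡ t ↑ʳ j
  i≡j = lookup-injective distinct (i ↑ˡ t) (t ↑ʳ j)
    (trans (Vec.lookup-++ˡ u v i) (trans uᵢ≡vⱼ (sym (Vec.lookup-++ʳ u v j))))
  inj₁≡inj₂ : inj₁ i ≡ inj₂ j
  inj₁≡inj₂ = trans (sym (Fin.splitAt-↑ˡ t i t)) (trans (cong (splitAt t) i≡j) (Fin.splitAt-↑ʳ t t j))

theorem2p15 : ∀ (ε : ℝ) (0<ε : 0ℚ <ʳ ε) → ε ≤ʳ fromℕ 2 →
    ∀ (r : ℕ) → r ≥ 3 →
    ∀ (n : ℕ) (G : Graph n) → UltraMaximalKFree ε r G →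
    ν-bi G ≤ quotient (fromℕ 2) ε 0<ε ^ʳ quotient (fromℕ 2) ε 0<ε
theorem2p15 ε 0<ε ε≤2 (suc (suc k)) (s≤s (s≤s _)) n G (free , dense) p a b 2/ε<p 2/ε<a/b =
  let ℓ , 0<ℓ , εℓ , 2<pℓ , 2<aℓ/b = common-witness ε p (+ a ℚ./ b) 0<2 0<2 2/ε<p 2/ε<a/b
      c , d , 0<c , ℓd≡c = positive-fraction 0<ℓ
      e , size , ec≤d = bound n G free c d 0<c λ x y x≢y ¬xy →
        clear-denominator ℓ c d ℓd≡c (n ^ k) (copies G k (N G x ∩ N G y)) (dense x y x≢y ¬xy ℓ εℓ)
  in power-bound {p = p} 0<c ℓd≡c 0<ℓ (ε≤2 ℓ εℓ) 2<pℓ e a b size ec≤d 2<aℓ/b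
  where
  0<2 : 0ℚ ℚ.< fromℕ 2
  0<2 = fromℕ-mono-< (s≤s z≤n)
  bound : ∀ n (G : Graph n) → KFree (2 + k) G → ∀ c d → 0 < c →
    (∀ x y → x ≢ y → ¬ Adj G x y → c * n ^ k ≤ d * copies G k (N G x ∩ N G y)) →
    ∃[ e ] c ^ e * ν-bi G ≤ (2 * d) ^ e × e * c ≤ d
  -- Without vertices n^k may be zero, which `matching-bound` excludes; but then `ν-bi G` is 0 and e
  -- = 0 works.
  bound zero    _ _    _ _ _   _     = 0 , z≤n , z≤n
  bound n@(suc _) G free c d 0<c dense =
    let u , v , distinct , adj⇔≡ = ν-bi-attained G
    in matching-bound G k c d (lookup u) (lookup v) 0<c (ℕ.m^n>0 n k) free dense
         (λ i → Equivalence.from (adj⇔≡ i i) refl)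
         (λ {i} {j} i≢j → i≢j ∘ Equivalence.to (adj⇔≡ i j))
         (matching-disjoint u v distinct)
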